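{- Let $\mathcal I$ be an ideal on $\omega$, let $\mathcal K\subseteq\mathcal I$ be hereditary and tall, and let $\mathcal B$ be a barrier on an infinite set $M\subseteq\omega$. If $\mathcal I$ is $\mathcal B$-Ramsey, then for every $X\in\mathcal I^+$ with $X\subseteq M$ there is $H\in\mathcal I^+$, $H\subseteq X$, with $\mathcal B\upharpoonright H\subseteq\mathcal K$.
   Context: All ideals on $\omega$ are proper and contain all finite sets. $\mathcal I^+=\mathcal P(\omega)\setminus\mathcal I$. A family of subsets of $\omega$ is tall if every infinite subset of $\omega$ has an infinite subset in it; it is hereditary if closed under subsets. For infinite $M\subseteq\omega$, a barrier on $M$ is a family $\mathcal B$ of nonempty finite subsets of $M$ such that every infinite subset of $M$ has an initial segment in $\mathcal B$ and no member of $\mathcal B$ is a proper subset of another. $\mathcal B\upharpoonright X=\{s\in\mathcal B:s\subseteq X\}$. $\mathcal I$ is $\mathcal B$-Ramsey if for every $X\in\mathcal I^+$ with $X\subseteq M$ and every colouring of $\mathcal B\upharpoonright X$ with finitely many colours there is $H\subseteq X$, $H\in\mathcal I^+$, such that the colouring is constant on $\mathcal B\upharpoonright H$. -}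

module Defs where

open import Data.Fin.Base using (Fin)
open import Data.List.Base using (List)
import Data.List.Membership.Propositional as List
open import Data.Nat.Base using (ℕ; _≤_)
open import Data.Product.Base using (_×_; ∃; ∃-syntax)
open import Level using (Level; 0ℓ) renaming (suc to lsuc)
open import Relation.Binary.Definitions using (_Respects_)
open import Relation.Binary.PropositionalEquality.Core using (_≡_)
open import Relation.Nullary.Negation.Core using (¬_)
open import Relation.Unary
  using (Pred; _∈_; _∉_; _⊆_; _⊂_; _≐_; _∪_; U; ∁; Satisfiable)

private
  variable
    ℓ : Level

-- Equality of subsets is mutual inclusion _≐_, since predicates are
-- not extensional for _≡_.

Subset : Set₁
Subset = Pred ℕ 0ℓ

Family : (ℓ : Level) → Set (lsuc 0ℓ Level.⊔ lsuc ℓ)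
Family ℓ = Pred Subset ℓ

Finite : Subset → Set
Finite S = ∃[ xs ] (S ≐ (List._∈ xs))

Infinite : Subset → Set
Infinite S = ¬ Finite S

Hereditary : Family ℓ → Set _
Hereditary K = ∀ {S T : Subset} → S ⊆ T → T ∈ K → S ∈ K

Tall : Family ℓ → Set _
Tall K = ∀ (S : Subset) → Infinite S →
         ∃[ T ] (T ⊆ S × Infinite T × T ∈ K)

record IsIdeal (I : Family ℓ) : Set (lsuc 0ℓ Level.⊔ ℓ) where
  field
    hereditary : Hereditary I
    ∪-closed   : ∀ {S T : Subset} → S ∈ I → T ∈ I → (S ∪ T) ∈ I
    finite     : ∀ {S : Subset} → Finite S → S ∈ I
    proper     : U ∉ I

infix 30 _⁺

_⁺ : Family ℓ → Family ℓ
I ⁺ = ∁ I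

_InitialSegmentOf_ : Subset → Subset → Set
s InitialSegmentOf S =
  s ⊆ S × (∀ {m n} → m ∈ s → n ∈ S → n ≤ m → n ∈ s)

-- The field respects-≐ says that B is a family of sets, not of
-- presentations of sets by predicates. For ideals and hereditary
-- families this is automatic.

record IsBarrier (M : Subset) (B : Family ℓ) : Set (lsuc 0ℓ Level.⊔ ℓ) where
  field
    respects-≐     : B Respects _≐_
    subset         : ∀ {s : Subset} → s ∈ B → s ⊆ M
    finite         : ∀ {s : Subset} → s ∈ B → Finite s
    nonempty       : ∀ {s : Subset} → s ∈ B → Satisfiable s
    initialSegment : ∀ (S : Subset) → Infinite S → S ⊆ M →
                     ∃[ s ] (s ∈ B × s InitialSegmentOf S)
    antichain      : ∀ {s t : Subset} → s ∈ B → t ∈ B → ¬ (s ⊂ t)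

infix 25 _↾_

_↾_ : Family ℓ → Subset → Family ℓ
(B ↾ X) s = s ∈ B × s ⊆ X

-- Because of the field cong, the colour of a set depends neither on
-- the predicate presenting it nor on the proof of its membership.

record Colouring (B : Family ℓ) (k : ℕ) : Set (lsuc 0ℓ Level.⊔ ℓ) where
  field
    colour : (s : Subset) → s ∈ B → Fin k
    cong   : ∀ {s t : Subset} (p : s ∈ B) (q : t ∈ B) →
             s ≐ t → colour s p ≡ colour t q

ConstantOn : {B : Family ℓ} {k : ℕ} → Colouring B k → Family ℓ → Set _
ConstantOn {B = B} c C =
  ∀ {s t : Subset} (p : s ∈ B) (q : t ∈ B) → s ∈ C → t ∈ C →
  Colouring.colour c s p ≡ Colouring.colour c t q

IsRamsey : (M : Subset) (B I : Family ℓ) → Set _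
IsRamsey M B I =
  ∀ (X : Subset) → X ∈ I ⁺ → X ⊆ M →
  ∀ (k : ℕ) (c : Colouring (B ↾ X) k) →
  ∃[ H ] (H ⊆ X × H ∈ I ⁺ × ConstantOn c (B ↾ H))

{-# OPTIONS --safe #-}
module Submission where

open import Defs
open import Axiom.ExcludedMiddle using (ExcludedMiddle)
open import Data.Fin.Base using (Fin; zero; suc)
open import Data.Product.Base using (_×_; _,_; proj₁; proj₂; ∃-syntax)
open import Level using (Level)
open import Relation.Binary.PropositionalEquality.Core using (_≡_; refl)
open import Relation.Nullary.Decidable.Core using (Dec; yes; no)
open import Relation.Nullary.Negation.Core using (contradiction)
open import Relation.Unary using (_∈_; _⊆_)

-- Colour the members of B ↾ X according to whether they belong to K, and let
-- H ∈ I⁺ be homogeneous. H is infinite, so by tallness it contains an infinite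
-- T ∈ K; the initial segment of T lying in B is then in K by heredity, hence
-- the constant colour on B ↾ H is the colour of the members of K.

private
  variable
    a b ℓ : Level
    P : Set a
    Q : Set b

decColour : Dec P → Fin 2
decColour (yes _) = zero
decColour (no _)  = suc zero

decColour-cong : (P → Q) → (Q → P) → (p? : Dec P) (q? : Dec Q) →
                 decColour p? ≡ decColour q?
decColour-cong f g (yes p) (yes q) = refl
decColour-cong f g (yes p) (no ¬q) = contradiction (f p) ¬q
decColour-cong f g (no ¬p) (yes q) = contradiction (g q) ¬p
decColour-cong f g (no ¬p) (no ¬q) = refl

-- The case `yes`, `no` would equate `zero` with `suc zero`, so it needs no clause. This lets
-- membership in `K` pass between sets of equal colour.
decColour-reflects : (p? : Dec P) (q? : Dec Q) →
                     decColour p? ≡ decColour q? → P → Q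
decColour-reflects p?      (yes q) eq p = q
decColour-reflects (no ¬p) (no ¬q) eq p = contradiction p ¬p

-- Heredity, applied to both inclusions of `s ≐ t`, makes the colour independent of the predicate
-- presenting a set.
membershipColouring : ExcludedMiddle ℓ → {K : Family ℓ} → Hereditary K →
                      (C : Family ℓ) → Colouring C 2
membershipColouring em {K} hered C = record
  { colour = λ s _ → decColour (em {s ∈ K})
  ; cong   = λ _ _ s≐t →
      decColour-cong (hered (proj₂ s≐t)) (hered (proj₁ s≐t)) em em
  }

lemma6p1 : ∀ {ℓ : Level} → ExcludedMiddle ℓ →
    (I : Family ℓ) → IsIdeal I →
    (K : Family ℓ) → K ⊆ I → Hereditary K → Tall K →
    (M : Subset) → Infinite M →
    (B : Family ℓ) → IsBarrier M B →
    IsRamsey M B I →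
    (X : Subset) → X ∈ I ⁺ → X ⊆ M →
    ∃[ H ] (H ∈ I ⁺ × H ⊆ X × B ↾ H ⊆ K)
lemma6p1 em I ideal K _ hered tall M _ B barrier ramsey X X∈I⁺ X⊆M
  with ramsey X X∈I⁺ X⊆M 2 (membershipColouring em {K} hered (B ↾ X))
... | H , H⊆X , H∈I⁺ , constant
  -- A finite `H` would belong to the ideal.
  with tall H (λ fin → H∈I⁺ (IsIdeal.finite ideal fin))
... | T , T⊆H , T-infinite , T∈K
  with IsBarrier.initialSegment barrier T T-infinite (λ n∈T → X⊆M (H⊆X (T⊆H n∈T)))
... | s , s∈B , s⊆T , _ = H , H∈I⁺ , H⊆X , B↾H⊆K
  where
  B↾H⊆K : B ↾ H ⊆ K
  B↾H⊆K (t∈B , t⊆H) = decColour-reflects em em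
    -- Colours are defined on `B ↾ X` but constant on `B ↾ H`, so `s` and `t` are each placed in
    -- both families.
    (constant (s∈B , λ n∈s → H⊆X (T⊆H (s⊆T n∈s))) (t∈B , λ n∈t → H⊆X (t⊆H n∈t))
              (s∈B , λ n∈s → T⊆H (s⊆T n∈s)) (t∈B , t⊆H))
    (hered s⊆T T∈K)
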